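{- For any consecutive pattern $\sigma$, the vincular patterns $1\oplus\sigma$ and $1\ominus\sigma$ are filling-shape-Wilf-equivalent.
   Context: A vincular pattern of length $k$ is a pair $(\sigma,X)$ with $\sigma\in S_k$ and $X\subseteq[k-1]$. It is consecutive if $X=[k-1]$, and it is written with a dash between positions $j,j+1$ exactly when $j\notin X$. For $(\alpha,A)$ of length $k$ and $(\tau,B)$ of length $\ell$: - direct sum: $(\alpha,A)\oplus(\tau,B)=(\alpha_1\cdots\alpha_k(\tau_1+k)\cdots(\tau_\ell+k),\ A\cup\{i+k:i\in B\})$; - skew sum: $(\alpha,A)\ominus(\tau,B)=((\alpha_1+\ell)\cdots(\alpha_k+\ell)\tau_1\cdots\tau_\ell,\ A\cup\{i+k:i\in B\})$. Here $1$ denotes the pattern $(1,\emptyset)$. For example, $1\oplus 12=1\text{ - }23$ and $1\ominus12=3\text{ - }12$. A Young board $\lambda=(\lambda_1,\dots,\lambda_n)$ with $\lambda_1\ge\dots\ge\lambda_n>0$ is the cell set $\{(i,j):1\le i\le n,\ 1\le j\le\lambda_i\}$, with width $n$ and height $\lambda_1$. A filling is a $0/1$ assignment to the cells with at most one $1$ per row and per column. It is encoded by the word $\pi_1\cdots\pi_n$ with $\pi_c=r$ if $(c,r)$ holds a $1$ and $\pi_c=\square$ if column $c$ is empty. A filling $\pi$ contains $(\sigma,X)$ if there are $i_1<\dots<i_k$ such that all of the following hold: - all $\pi_{i_j}$ are numbers; - $\pi_{i_1}\cdots\pi_{i_k}$ is order-isomorphic to $\sigma$; - $i_{j+1}=i_j+1$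 for $j\in X$; - the cell $(i_k,\max_j\pi_{i_j})$ lies in $\lambda$. Otherwise $\pi$ avoids $(\sigma,X)$. $\mathcal{S}_\lambda^{C,R}(\sigma)$ denotes the set of fillings of $\lambda$ with empty columns exactly $C$ and empty rows exactly $R$ that avoid $\sigma$. Patterns $\sigma,\tau$ are filling-shape-Wilf-equivalent if $|\mathcal{S}_\lambda^{C,R}(\sigma)|=|\mathcal{S}_\lambda^{C,R}(\tau)|$ for all Young boards $\lambda$ and all $C\subseteq[\text{width}]$, $R\subseteq[\text{height}]$. -}

module Defs where

open import Data.Nat using (ℕ; zero; suc; _+_; _∸_; _≤_; _<_; _<ᵇ_)
open import Data.Bool using (Bool; true; false; _∨_; _∧_)
open import Data.Fin using (Fin; toℕ) renaming (_<_ to _<ᶠ_; _≤_ to _≤ᶠ_)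
open import Data.Fin.Subset using (Subset; _∈_)
open import Data.Vec using (Vec; []; _∷_; lookup; map; _++_)
open import Data.Maybe using (Maybe; just; nothing)
open import Data.Product using (Σ; _×_; ∃; proj₁)
open import Relation.Nullary using (¬_)
open import Relation.Binary.PropositionalEquality using (_≡_; _≢_; refl; sym; trans; isEquivalence)
open import Relation.Binary.Bundles using (Setoid)
open import Function.Bundles using (Inverse)
open import Function using (_⇔_)
open import Level using (0ℓ)

-- Vincular patterns (raw data).  Positions are 0-based Fin indices
-- internally; entry values and the adjacency set X are 1-based as in
-- the paper: X j = true means j ∈ X, i.e. positions j and j+1 (1-based)
-- must be adjacent.

record Pat : Set where
  constructor pat
  field
    len  : ℕ
    perm : Vec ℕ len
    X    : ℕ → Bool
open Pat public

IsPattern : Pat → Set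
IsPattern p =
  (∀ i → 1 ≤ lookup (perm p) i × lookup (perm p) i ≤ len p) ×
  (∀ i j → lookup (perm p) i ≡ lookup (perm p) j → i ≡ j) ×
  (∀ j → X p j ≡ true → 1 ≤ j × suc j ≤ len p)

Consecutive : Pat → Set
Consecutive p = ∀ j → (X p j ≡ true) ⇔ (1 ≤ j × suc j ≤ len p)

one : Pat
one = pat 1 (1 ∷ []) (λ _ → false)

shiftSet : ℕ → (ℕ → Bool) → ℕ → Bool
shiftSet k B j = (k <ᵇ j) ∧ B (j ∸ k)

infixl 6 _⊕_ _⊖_

_⊕_ : Pat → Pat → Pat
pat k α A ⊕ pat l τ B = pat (k + l) (α ++ map (_+ k) τ) (λ j → A j ∨ shiftSet k B j)

_⊖_ : Pat → Pat → Pat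
pat k α A ⊖ pat l τ B = pat (k + l) (map (_+ l) α ++ τ) (λ j → A j ∨ shiftSet k B j)

-- Young boards: λ = (λ₁,…,λₙ), λ₁ ≥ ⋯ ≥ λₙ > 0; column c (0-based Fin)
-- has cells (c+1, 1), …, (c+1, λ_{c+1}).

IsYoung : ∀ {n} → Vec ℕ n → Set
IsYoung {n} lam =
  (∀ (i j : Fin n) → i ≤ᶠ j → lookup lam j ≤ lookup lam i) ×
  (∀ (i : Fin n) → 1 ≤ lookup lam i)

height : ∀ {n} → Vec ℕ n → ℕ
height []      = 0
height (h ∷ _) = h

-- A filling is encoded by its word π : π_c = just r if (c,r) holds a 1,
-- nothing if column c is empty.
IsFilling : ∀ {n} → Vec ℕ n → Vec (Maybe ℕ) n → Set
IsFilling {n} lam π =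
  (∀ c r → lookup π c ≡ just r → 1 ≤ r × r ≤ lookup lam c) ×
  (∀ c c' r → lookup π c ≡ just r → lookup π c' ≡ just r → c ≡ c')

Contains : ∀ {n} → Vec ℕ n → Vec (Maybe ℕ) n → Pat → Set
Contains {n} lam π (pat k σ Xp) =
  Σ (Fin k → Fin n) λ ι → Σ (Fin k → ℕ) λ v →
    (∀ a b → a <ᶠ b → ι a <ᶠ ι b) ×
    (∀ a → lookup π (ι a) ≡ just (v a)) ×
    (∀ a b → (v a < v b) ⇔ (lookup σ a < lookup σ b)) ×
    (∀ a b → toℕ b ≡ suc (toℕ a) → Xp (suc (toℕ a)) ≡ true →
       toℕ (ι b) ≡ suc (toℕ (ι a))) ×
    -- the cell (i_k, max_j π_{i_j}) lies in λ
    (∀ a l → toℕ l ≡ k ∸ 1 → v a ≤ lookup lam (ι l))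

Avoids : ∀ {n} → Vec ℕ n → Vec (Maybe ℕ) n → Pat → Set
Avoids lam π p = ¬ Contains lam π p

EmptyCols : ∀ {n} → Vec (Maybe ℕ) n → Subset n → Set
EmptyCols π C = ∀ c → (c ∈ C) ⇔ (lookup π c ≡ nothing)

EmptyRows : ∀ {n} (lam : Vec ℕ n) → Vec (Maybe ℕ) n → Subset (height lam) → Set
EmptyRows lam π R = ∀ r → (r ∈ R) ⇔ (∀ c → lookup π c ≢ just (suc (toℕ r)))

-- S_λ^{C,R}(p), as a setoid: two elements are equal iff their fillings
-- (words) are equal; the proof components are irrelevant.
Fill : ∀ {n} (lam : Vec ℕ n) → Subset n → Subset (height lam) → Pat → Set
Fill {n} lam C R p = Σ (Vec (Maybe ℕ) n) λ π →
  IsFilling lam π × EmptyCols π C × EmptyRows lam π R × Avoids lam π p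

FillSetoid : ∀ {n} (lam : Vec ℕ n) → Subset n → Subset (height lam) → Pat → Setoid 0ℓ 0ℓ
FillSetoid lam C R p = record
  { Carrier       = Fill lam C R p
  ; _≈_           = λ s t → proj₁ s ≡ proj₁ t
  ; isEquivalence = record { refl = refl ; sym = sym ; trans = trans }
  }

-- filling-shape-Wilf-equivalence: |S_λ^{C,R}(p)| = |S_λ^{C,R}(q)| for all
-- Young boards λ and all C, R, expressed as a bijection of these finite sets.
FSWE : Pat → Pat → Set
FSWE p q = ∀ n (lam : Vec ℕ n) → IsYoung lam →
  (C : Subset n) (R : Subset (height lam)) →
  Inverse (FillSetoid lam C R p) (FillSetoid lam C R q)

{-# OPTIONS --safe #-}
-- Fill the columns from right to left.  A nonempty column c then picks one of the a free rows of height
-- at most λ_c (not in R, not used to the right), and a filling amounts to the ranks of these picks.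
-- The bijection replaces every rank r by r - 1 modulo a.
-- Since all rows outside R end up used, a window carrying σ extends to 1 ⊕ σ iff it misses the lowest
-- of the rows available to its last column, and to 1 ⊖ σ iff it misses the highest of them.
-- In a window missing the lowest row no rank is 0, so all picks drop by one rank: the order of the
-- entries is unchanged, they stay within the last column, and they miss the highest row; and conversely.
module Submission where

open import Defs
open import Data.Bool using (Bool; true; false; not; _∧_; if_then_else_)
open import Data.Bool.Properties using (∧-identityʳ; ∧-zeroʳ)
open import Data.Empty using (⊥-elim)
open import Data.Fin using (Fin; zero; suc; toℕ; fromℕ; fromℕ<; inject₁) renaming (_<_ to _<ᶠ_; _≤_ to _≤ᶠ_)
open import Data.Fin.Properties using (toℕ-injective; toℕ<n; toℕ-fromℕ; toℕ-fromℕ<; toℕ-inject₁; ≤fromℕ)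
  renaming (suc-injective to sucᶠ-injective)
open import Data.Fin.Induction using (>-weakInduction)
open import Data.Fin.Subset using (Subset; _∈_)
open import Data.Fin.Subset.Properties using (_∈?_)
open import Data.Maybe using (Maybe; just; nothing)
open import Data.Maybe.Properties using (just-injective)
open import Data.Nat
open import Data.Nat.Properties
open import Data.Product using (∃; _×_; _,_; proj₁; proj₂)
open import Data.Sum using (_⊎_; inj₁; inj₂)
open import Data.Vec using (Vec; []; _∷_; lookup; map)
open import Data.Vec.Properties using (lookup-map; []=⇒lookup; lookup⇒[]=)
open import Function using (_∘_; flip; _⇔_; mk⇔; Equivalence)
open import Function.Bundles using (Inverse)
import Function.Construct.Identity as Identity
open import Function.Properties.Equivalence using () renaming (sym to ⇔-sym; trans to ⇔-trans)
open import Relation.Binary.Definitions using (tri<; tri≈; tri>)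
open import Relation.Binary.PropositionalEquality
open import Relation.Nullary using (¬_; yes; no; contradiction)
open import Relation.Nullary.Decidable using (decidable-stable)

private
  variable
    n k : ℕ

true≢false : ∀ {b} → b ≡ true → b ≢ false
true≢false refl ()

-- Sets of rows, ranks, and selection by rank.

RowSet : Set
RowSet = ℕ → Bool

infix 4 _∈ʳ_
_∈ʳ_ : ℕ → RowSet → Set
u ∈ʳ P = P u ≡ true

infixl 6 _∖_
_∖_ : RowSet → ℕ → RowSet
(P ∖ x) u = P u ∧ not (u ≡ᵇ x)

≡ᵇ-refl : ∀ x → (x ≡ᵇ x) ≡ true
≡ᵇ-refl zero    = refl
≡ᵇ-refl (suc x) = ≡ᵇ-refl x

≢⇒≡ᵇ-false : ∀ u x → u ≢ x → (u ≡ᵇ x) ≡ false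
≢⇒≡ᵇ-false zero    zero    u≢x = contradiction refl u≢x
≢⇒≡ᵇ-false zero    (suc x) u≢x = refl
≢⇒≡ᵇ-false (suc u) zero    u≢x = refl
≢⇒≡ᵇ-false (suc u) (suc x) u≢x = ≢⇒≡ᵇ-false u x (u≢x ∘ cong suc)

∖-other : ∀ P {u x} → u ≢ x → (P ∖ x) u ≡ P u
∖-other P {u} {x} u≢x rewrite ≢⇒≡ᵇ-false u x u≢x = ∧-identityʳ (P u)

∖-self : ∀ P x → (P ∖ x) x ≡ false
∖-self P x rewrite ≡ᵇ-refl x = ∧-zeroʳ (P x)

∈-∖⁺ : ∀ P {u x} → u ∈ʳ P → u ≢ x → u ∈ʳ P ∖ x
∈-∖⁺ P u∈P u≢x = trans (∖-other P u≢x) u∈P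

∈-∖⁻ : ∀ P {u x} → u ∈ʳ P ∖ x → u ∈ʳ P × u ≢ x
∈-∖⁻ P {u} {x} u∈ = trans (sym (∖-other P u≢x)) u∈ , u≢x
  where
  u≢x : u ≢ x
  u≢x refl = true≢false u∈ (∖-self P u)

-- The bound is strict: `count P x` is the rank of `x` in `P`, starting from 0, and
-- `count P (suc h)` is the number of rows of `P` of height at most `h`.
count : RowSet → ℕ → ℕ
count P zero    = 0
count P (suc v) = if P v then suc (count P v) else count P v

count-suc-∈ : ∀ P {v} → v ∈ʳ P → count P (suc v) ≡ suc (count P v)
count-suc-∈ P v∈P rewrite v∈P = refl

count-suc-∉ : ∀ P {v} → P v ≡ false → count P (suc v) ≡ count P v
count-suc-∉ P v∉P rewrite v∉P = refl

count-≤-suc : ∀ P v → count P v ≤ count P (suc v)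
count-≤-suc P v with P v
... | true  = n≤1+n _
... | false = ≤-refl

count-mono : ∀ P {u v} → u ≤ v → count P u ≤ count P v
count-mono P {u} u≤v = go (≤⇒≤′ u≤v)
  where
  go : ∀ {v} → u ≤′ v → count P u ≤ count P v
  go ≤′-refl     = ≤-refl
  go (≤′-step p) = ≤-trans (go p) (count-≤-suc P _)

count-strict : ∀ P {u v} → u ∈ʳ P → u < v → count P u < count P v
count-strict P u∈P u<v = subst (_≤ _) (count-suc-∈ P u∈P) (count-mono P u<v)

count-reflects-< : ∀ P {u v} → count P u < count P v → u < v
count-reflects-< P lt = ≰⇒> (λ v≤u → <⇒≱ lt (count-mono P v≤u))

count-injective : ∀ P {u v} → u ∈ʳ P → v ∈ʳ P → count P u ≡ count P v → u ≡ v
count-injective P {u} {v} u∈ v∈ eq with <-cmp u v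
... | tri< u<v _ _ = contradiction eq (<⇒≢ (count-strict P u∈ u<v))
... | tri≈ _ u≡v _ = u≡v
... | tri> _ _ v<u = contradiction (sym eq) (<⇒≢ (count-strict P v∈ v<u))

count-∖-≤ : ∀ P {v x} → v ≤ x → count (P ∖ x) v ≡ count P v
count-∖-≤ P {zero}  v<x = refl
count-∖-≤ P {suc v} v<x
  rewrite ∖-other P (<⇒≢ v<x) | count-∖-≤ P (<⇒≤ v<x) = refl

count-∖-> : ∀ P {v x} → x ∈ʳ P → x < v → suc (count (P ∖ x) v) ≡ count P v
count-∖-> P {suc v} {x} x∈P (s≤s x≤v) with m≤n⇒m<n∨m≡n x≤v
... | inj₂ refl rewrite ∖-self P v | count-∖-≤ P (≤-refl {v}) | x∈P = refl
... | inj₁ x<v  rewrite ∖-other P (≢-sym (<⇒≢ x<v)) | sym (count-∖-> P x∈P x<v) with P v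
...   | true  = refl
...   | false = refl

-- nth P v s is the element of P of rank s below v; 0 if there is none.
nth : RowSet → ℕ → ℕ → ℕ
nth P zero    s = 0
nth P (suc v) s = if P v ∧ (count P v ≡ᵇ s) then v else nth P v s

nth-spec : ∀ P v {s} → s < count P v →
           nth P v s < v × nth P v s ∈ʳ P × count P (nth P v s) ≡ s
nth-spec P (suc v) {s} s<c with P v in eq
... | false = let p , q , r = nth-spec P v s<c in m<n⇒m<1+n p , q , r
... | true with <-cmp s (count P v)
...   | tri< s<c′ s≢c _ rewrite ≢⇒≡ᵇ-false (count P v) s (≢-sym s≢c) =
          let p , q , r = nth-spec P v s<c′ in m<n⇒m<1+n p , q , r
...   | tri≈ _ refl _ rewrite ≡ᵇ-refl (count P v) = ≤-refl , eq , refl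
...   | tri> _ _ c<s = contradiction s<c (≤⇒≯ c<s)

count≡0⇒∉ : ∀ P {u v} → count P v ≡ 0 → u < v → P u ≡ false
count≡0⇒∉ P {u} c≡0 u<v with P u in eq
... | false = refl
... | true  = contradiction c≡0 (≢-sym (<⇒≢ (≤-trans (s≤s z≤n) (count-strict P eq u<v))))

∉⇒count≡0 : ∀ P → (∀ u → P u ≡ false) → ∀ v → count P v ≡ 0
∉⇒count≡0 P none zero    = refl
∉⇒count≡0 P none (suc v) = trans (count-suc-∉ P (none v)) (∉⇒count≡0 P none v)

-- Free rows while the columns are filled from right to left.

Word : ℕ → Set
Word n = Vec (Maybe ℕ) n

avail : RowSet → Word n → RowSet
avail ok []            = ok
avail ok (nothing ∷ ρ) = avail ok ρ
avail ok (just x ∷ ρ)  = avail ok ρ ∖ x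

-- The rows still free when column c is filled, columns being processed from right to left.
after : RowSet → Word n → Fin n → RowSet
after ok (_ ∷ ρ) zero    = avail ok ρ
after ok (_ ∷ ρ) (suc c) = after ok ρ c

avail⁻ : ∀ ok (π : Word n) {u} → u ∈ʳ avail ok π → u ∈ʳ ok × (∀ c → lookup π c ≢ just u)
avail⁻ ok []            u∈ = u∈ , λ ()
avail⁻ ok (nothing ∷ ρ) u∈ =
  let u∈ok , unused = avail⁻ ok ρ u∈ in
  u∈ok , λ { zero () ; (suc c) → unused c }
avail⁻ ok (just x ∷ ρ)  u∈ =
  let u∈ρ , u≢x = ∈-∖⁻ (avail ok ρ) u∈
      u∈ok , unused = avail⁻ ok ρ u∈ρ in
  u∈ok , λ { zero e → u≢x (sym (just-injective e)) ; (suc c) → unused c }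

avail⁺ : ∀ ok (π : Word n) {u} → u ∈ʳ ok → (∀ c → lookup π c ≢ just u) → u ∈ʳ avail ok π
avail⁺ ok []            u∈ok unused = u∈ok
avail⁺ ok (nothing ∷ ρ) u∈ok unused = avail⁺ ok ρ u∈ok (unused ∘ suc)
avail⁺ ok (just x ∷ ρ)  u∈ok unused =
  ∈-∖⁺ (avail ok ρ) (avail⁺ ok ρ u∈ok (unused ∘ suc)) (λ u≡x → unused zero (cong just (sym u≡x)))

used : ∀ ok (π : Word n) {u} → u ∈ʳ ok → avail ok π u ≡ false → ∃ λ c → lookup π c ≡ just u
used ok []            u∈ok u∉ = contradiction u∉ (true≢false u∈ok)
used ok (nothing ∷ ρ) u∈ok u∉ = let c , e = used ok ρ u∈ok u∉ in suc c , e
used ok (just x ∷ ρ) {u} u∈ok u∉ with u ≟ x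
... | yes u≡x = zero , cong just (sym u≡x)
... | no  u≢x = let c , e = used ok ρ u∈ok (trans (sym (∖-other (avail ok ρ) u≢x)) u∉) in suc c , e

after⇒ok : ∀ ok (π : Word n) c {u} → u ∈ʳ after ok π c → u ∈ʳ ok
after⇒ok ok (_ ∷ ρ) zero    u∈ = proj₁ (avail⁻ ok ρ u∈)
after⇒ok ok (_ ∷ ρ) (suc c) u∈ = after⇒ok ok ρ c u∈

-- Rows used strictly to the right of `c` have already been removed from `after ok π c`; the row
-- used in `c` itself has not.
after⇒≤ : ∀ ok (π : Word n) c {u} → u ∈ʳ after ok π c → ∀ c′ → lookup π c′ ≡ just u → c′ ≤ᶠ c
after⇒≤ ok (_ ∷ ρ) c       u∈ zero     e = z≤n
after⇒≤ ok (_ ∷ ρ) zero    u∈ (suc c′) e = contradiction e (proj₂ (avail⁻ ok ρ u∈) c′)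
after⇒≤ ok (_ ∷ ρ) (suc c) u∈ (suc c′) e = s≤s (after⇒≤ ok ρ c u∈ c′ e)

avail⇒after : ∀ ok (π : Word n) c {u} → u ∈ʳ avail ok π → u ∈ʳ after ok π c
avail⇒after ok (nothing ∷ ρ) zero    u∈ = u∈
avail⇒after ok (just x ∷ ρ)  zero    u∈ = proj₁ (∈-∖⁻ (avail ok ρ) u∈)
avail⇒after ok (nothing ∷ ρ) (suc c) u∈ = avail⇒after ok ρ c u∈
avail⇒after ok (just x ∷ ρ)  (suc c) u∈ = avail⇒after ok ρ c (proj₁ (∈-∖⁻ (avail ok ρ) u∈))

after-mono : ∀ ok (π : Word n) {c d u} → c ≤ᶠ d → u ∈ʳ after ok π c → u ∈ʳ after ok π d
after-mono ok (_ ∷ ρ) {zero}  {zero}  c≤d       u∈ = u∈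
after-mono ok (_ ∷ ρ) {zero}  {suc d} c≤d       u∈ = avail⇒after ok ρ d u∈
after-mono ok (_ ∷ ρ) {suc c} {suc d} (s≤s c≤d) u∈ = after-mono ok ρ c≤d u∈

-- Adjacency of window columns enters here: columns in between could remove further rows.
after-pred : ∀ ok (π : Word n) c d {x} → toℕ d ≡ suc (toℕ c) → lookup π d ≡ just x →
             after ok π c ≡ after ok π d ∖ x
after-pred ok (_ ∷ y ∷ ρ) zero (suc zero) _ refl = refl
after-pred ok (_ ∷ ρ) (suc c) (suc d) eq e = after-pred ok ρ c d (cong pred eq) e

-- Words whose entries correspond by rank.

-- S a r r′ relates the ranks r, r′ of two entries among a free rows each.
data Ranked (S : ℕ → ℕ → ℕ → Set) (ok : RowSet) : Vec ℕ n → Word n → Word n → Set where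
  []    : Ranked S ok [] [] []
  empty : ∀ {h} {lam : Vec ℕ n} {ρ ρ′} → Ranked S ok lam ρ ρ′ →
          Ranked S ok (h ∷ lam) (nothing ∷ ρ) (nothing ∷ ρ′)
  entry : ∀ {h} {lam : Vec ℕ n} {ρ ρ′ x x′} →
          x ≤ h → x ∈ʳ avail ok ρ → x′ ≤ h → x′ ∈ʳ avail ok ρ′ →
          count (avail ok ρ) (suc h) ≡ count (avail ok ρ′) (suc h) →
          S (count (avail ok ρ) (suc h)) (count (avail ok ρ) x) (count (avail ok ρ′) x′) →
          Ranked S ok lam ρ ρ′ →
          Ranked S ok (h ∷ lam) (just x ∷ ρ) (just x′ ∷ ρ′)

-- `S` is stated with the number of free rows of the first word; the stored equality of counts
-- rewrites it for the second.
Ranked-sym : ∀ {S ok} {lam : Vec ℕ n} {π π′} →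
             Ranked S ok lam π π′ → Ranked (λ a → flip (S a)) ok lam π′ π
Ranked-sym [] = []
Ranked-sym (empty R) = empty (Ranked-sym R)
Ranked-sym {S = S} (entry p q p′ q′ a s R) =
  entry p′ q′ p q (sym a) (subst (λ b → S b _ _) a s) (Ranked-sym R)

-- Once the columns to the right agree, the free rows agree too, and within them a rank determines
-- its row. Both round trips of the bijection are settled by this.
Ranked-functional : ∀ {S ok} {lam : Vec ℕ n} {π π₁ π₂} →
                    (∀ {a r s t} → S a r s → S a r t → s ≡ t) →
                    Ranked S ok lam π π₁ → Ranked S ok lam π π₂ → π₁ ≡ π₂
Ranked-functional fn [] [] = refl
Ranked-functional fn (empty R₁) (empty R₂) = cong (nothing ∷_) (Ranked-functional fn R₁ R₂)
Ranked-functional {ok = ok} fn (entry {ρ′ = ρ′} _ _ _ q₁ _ s₁ R₁) (entry _ _ _ q₂ _ s₂ R₂)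
  with Ranked-functional fn R₁ R₂
... | refl = cong (λ x → just x ∷ ρ′) (count-injective (avail ok ρ′) q₁ q₂ (fn s₁ s₂))

-- All picks lie at height at most `h`, so each nonempty column takes exactly one row from either
-- count.
Ranked-count : ∀ {S ok} {lam : Vec ℕ n} {π π′ h} → (∀ c → lookup lam c ≤ h) →
               Ranked S ok lam π π′ → count (avail ok π) (suc h) ≡ count (avail ok π′) (suc h)
Ranked-count below [] = refl
Ranked-count below (empty R) = Ranked-count (below ∘ suc) R
Ranked-count {ok = ok} below (entry {ρ = ρ} {ρ′} p q p′ q′ _ _ R) = cong pred
  (trans (count-∖-> (avail ok ρ) q (s≤s (≤-trans p (below zero))))
  (trans (Ranked-count (below ∘ suc) R)
    (sym (count-∖-> (avail ok ρ′) q′ (s≤s (≤-trans p′ (below zero)))))))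

Ranked-empty : ∀ {S ok} {lam : Vec ℕ n} {π π′} → Ranked S ok lam π π′ →
               ∀ c → lookup π c ≡ nothing → lookup π′ c ≡ nothing
Ranked-empty (empty R)             zero    e = refl
Ranked-empty (empty R)             (suc c) e = Ranked-empty R c e
Ranked-empty (entry _ _ _ _ _ _ R) (suc c) e = Ranked-empty R c e

record RankedAt (S : ℕ → ℕ → ℕ → Set) (ok : RowSet) (h : ℕ) (P P′ : RowSet) (x x′ : ℕ) : Set where
  field
    x≤h        : x ≤ h
    x∈P        : x ∈ʳ P
    x′≤h       : x′ ≤ h
    x′∈P′      : x′ ∈ʳ P′
    same-count : count P (suc h) ≡ count P′ (suc h)
    ranks      : S (count P (suc h)) (count P x) (count P′ x′)

Ranked-lookup : ∀ {S ok} {lam : Vec ℕ n} {π π′} → Ranked S ok lam π π′ →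
  ∀ c {x} → lookup π c ≡ just x → ∃ λ x′ → lookup π′ c ≡ just x′ ×
  RankedAt S ok (lookup lam c) (after ok π c) (after ok π′ c) x x′
Ranked-lookup (entry {x′ = x′} p q p′ q′ a s R) zero refl = x′ , refl , record
  { x≤h = p ; x∈P = q ; x′≤h = p′ ; x′∈P′ = q′ ; same-count = a ; ranks = s }
Ranked-lookup (empty R)             (suc c) e = Ranked-lookup R c e
Ranked-lookup (entry _ _ _ _ _ _ R) (suc c) e = Ranked-lookup R c e

-- A filling with entries drawn from `ok`. That every row of `ok` gets used is treated separately,
-- as emptiness of `avail`.
Admissible : RowSet → Vec ℕ n → Word n → Set
Admissible ok lam π =
  (∀ c x → lookup π c ≡ just x → x ∈ʳ ok × x ≤ lookup lam c) ×
  (∀ c c′ x → lookup π c ≡ just x → lookup π c′ ≡ just x → c ≡ c′)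

Decreasing : Vec ℕ n → Set
Decreasing {n} lam = ∀ (i j : Fin n) → i ≤ᶠ j → lookup lam j ≤ lookup lam i

-- For distinctness: an entry is free at its own column, so no column further right holds it.
-- Applied both ways, this makes two columns with the same entry coincide.
Ranked⇒Admissible : ∀ {S ok} {lam : Vec ℕ n} {π π′} → Ranked S ok lam π π′ → Admissible ok lam π
Ranked⇒Admissible {ok = ok} {π = π} R = bounds , λ c c′ x e e′ →
  toℕ-injective (≤-antisym (before c′ c x e′ e) (before c c′ x e e′))
  where
  bounds : ∀ c x → lookup π c ≡ just x → x ∈ʳ ok × x ≤ _
  bounds c x e = let _ , _ , at = Ranked-lookup R c e
                     open RankedAt at in after⇒ok ok π c x∈P , x≤h
  before : ∀ c c′ x → lookup π c ≡ just x → lookup π c′ ≡ just x → c′ ≤ᶠ c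
  before c c′ x e e′ = let _ , _ , at = Ranked-lookup R c e
                           open RankedAt at in after⇒≤ ok π c x∈P c′ e′

-- Replacing the ranks in a word.

module _ (ok : RowSet) (g : ℕ → ℕ → ℕ) where

  rerank : Vec ℕ n → Word n → Word n
  rerank []        []            = []
  rerank (h ∷ lam) (nothing ∷ ρ) = nothing ∷ rerank lam ρ
  rerank (h ∷ lam) (just x ∷ ρ)  = just x′ ∷ ρ′
    where
    ρ′ = rerank lam ρ
    x′ = nth (avail ok ρ′) (suc h) (g (count (avail ok ρ) (suc h)) (count (avail ok ρ) x))

  -- Columns further right are no higher than the current one, so by `Ranked-count` both words leave
  -- it equally many free rows. Hence the new rank `g a r`, being below `a`, is realised by `nth`.
  Ranked-rerank : ∀ {S} → (∀ {a r} → r < a → g a r < a × S a r (g a r)) →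
                  (lam : Vec ℕ n) → Decreasing lam → ∀ π → Admissible ok lam π →
                  Ranked S ok lam π (rerank lam π)
  Ranked-rerank g-ok []        dec []            adm = []
  Ranked-rerank {S = S} g-ok (h ∷ lam) dec (m ∷ ρ) (bounds , inj) = go m refl
    where
    R : Ranked S ok lam ρ (rerank lam ρ)
    R = Ranked-rerank g-ok lam (λ i j i≤j → dec (suc i) (suc j) (s≤s i≤j)) ρ
          ((λ c → bounds (suc c)) , λ c c′ x e e′ → sucᶠ-injective (inj (suc c) (suc c′) x e e′))
    same : count (avail ok ρ) (suc h) ≡ count (avail ok (rerank lam ρ)) (suc h)
    same = Ranked-count (λ c → dec zero (suc c) z≤n) R
    go : ∀ m′ → m ≡ m′ → Ranked S ok (h ∷ lam) (m′ ∷ ρ) (rerank (h ∷ lam) (m′ ∷ ρ))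
    go nothing  _    = empty R
    go (just x) refl with bounds zero x refl
    ... | x∈ok , x≤h = entry x≤h x∈ (s≤s⁻¹ lt) mem same (subst (S _ _) (sym rank) s) R
      where
      x∈ : x ∈ʳ avail ok ρ
      x∈ = avail⁺ ok ρ x∈ok (λ c e → contradiction (inj zero (suc c) x refl e) λ ())
      g< = proj₁ (g-ok (count-strict (avail ok ρ) x∈ (s≤s x≤h)))
      s  = proj₂ (g-ok (count-strict (avail ok ρ) x∈ (s≤s x≤h)))
      spec = nth-spec (avail ok (rerank lam ρ)) (suc h) (subst (_ <_) same g<)
      lt   = proj₁ spec
      mem  = proj₁ (proj₂ spec)
      rank = proj₂ (proj₂ spec)

-- Cyclic rotation of ranks.

-- The graph of `r - 1` modulo `a`, with the genuine shift and the wraparound as separate cases.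
Rotation : ℕ → ℕ → ℕ → Set
Rotation a r s = (r ≡ suc s × r < a) ⊎ (r ≡ 0 × suc s ≡ a)

down : ℕ → ℕ → ℕ
down a zero    = pred a
down a (suc r) = r

up : ℕ → ℕ → ℕ
up a s = if suc s ≡ᵇ a then 0 else suc s

down-rotation : ∀ {a r} → r < a → down a r < a × Rotation a r (down a r)
down-rotation {suc a} {zero}  _   = ≤-refl , inj₂ (refl , refl)
down-rotation {a}     {suc r} r<a = <⇒≤ r<a , inj₁ (refl , r<a)

up-rotation : ∀ {a s} → s < a → up a s < a × Rotation a (up a s) s
up-rotation {a} {s} s<a with suc s ≟ a
... | yes refl rewrite ≡ᵇ-refl s = s≤s z≤n , inj₂ (refl , refl)
... | no  neq  rewrite ≢⇒≡ᵇ-false (suc s) a neq =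
        ≤∧≢⇒< s<a neq , inj₁ (refl , ≤∧≢⇒< s<a neq)

Rotation-functional : ∀ {a r s t} → Rotation a r s → Rotation a r t → s ≡ t
Rotation-functional (inj₁ (refl , _)) (inj₁ (refl , _)) = refl
Rotation-functional (inj₂ (refl , p)) (inj₂ (_ , q))    = cong pred (trans p (sym q))
Rotation-functional (inj₁ (refl , _)) (inj₂ (() , _))
Rotation-functional (inj₂ (refl , _)) (inj₁ (() , _))

Rotation-injective : ∀ {a r s t} → Rotation a s r → Rotation a t r → s ≡ t
Rotation-injective (inj₁ (refl , _))   (inj₁ (refl , _))   = refl
Rotation-injective (inj₂ (refl , _))   (inj₂ (refl , _))   = refl
Rotation-injective (inj₁ (refl , s<a)) (inj₂ (_ , refl))   = contradiction s<a (<-irrefl refl)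
Rotation-injective (inj₂ (_ , refl))   (inj₁ (refl , t<a)) = contradiction t<a (<-irrefl refl)

-- Rank shifts throughout a window of adjacent columns.

-- Restoring `x` raises exactly the ranks of the rows above it. As the ranks of `x` and `x′` also
-- differ by one, `u` lies above `x` exactly when `u′` lies above `x′`; the two mixed cases
-- contradict the counts.
∖-shift : ∀ P P′ {x x′ u u′} → x ∈ʳ P → x′ ∈ʳ P′ → count P x ≡ suc (count P′ x′) →
          u ∈ʳ P ∖ x → u′ ∈ʳ P′ ∖ x′ → count (P ∖ x) u ≡ suc (count (P′ ∖ x′) u′) →
          count P u ≡ suc (count P′ u′)
∖-shift P P′ {x} {x′} {u} {u′} x∈ x′∈ eqx u∈ u′∈ eq
  with <-cmp x u | <-cmp x′ u′
... | tri≈ _ x≡u _ | _ = contradiction (sym x≡u) (proj₂ (∈-∖⁻ P u∈))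
... | tri< _ _ _ | tri≈ _ x≡u _ = contradiction (sym x≡u) (proj₂ (∈-∖⁻ P′ u′∈))
... | tri> _ _ _ | tri≈ _ x≡u _ = contradiction (sym x≡u) (proj₂ (∈-∖⁻ P′ u′∈))
... | tri< x<u _ _ | tri< x′<u′ _ _ =
  trans (sym (count-∖-> P x∈ x<u)) (cong suc (trans eq (count-∖-> P′ x′∈ x′<u′)))
... | tri> _ _ u<x | tri> _ _ u′<x′ =
  trans (sym (count-∖-≤ P (<⇒≤ u<x))) (trans eq (cong suc (count-∖-≤ P′ (<⇒≤ u′<x′))))
... | tri< x<u _ _ | tri> _ _ u′<x′ = ⊥-elim (<-irrefl refl (begin-strict
  count P x                       <⟨ count-strict P x∈ x<u ⟩
  count P u                       ≡⟨ count-∖-> P x∈ x<u ⟨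
  suc (count (P ∖ x) u)           ≡⟨ cong suc eq ⟩
  suc (suc (count (P′ ∖ x′) u′))  ≡⟨ cong (2 +_) (count-∖-≤ P′ (<⇒≤ u′<x′)) ⟩
  suc (suc (count P′ u′))         ≤⟨ s≤s (count-strict P′ (proj₁ (∈-∖⁻ P′ u′∈)) u′<x′) ⟩
  suc (count P′ x′)               ≡⟨ eqx ⟨
  count P x                       ∎))
  where open ≤-Reasoning
... | tri> _ _ u<x | tri< x′<u′ _ _ = ⊥-elim (<-irrefl refl (begin-strict
  count P u                  <⟨ count-strict P (proj₁ (∈-∖⁻ P u∈)) u<x ⟩
  count P x                  ≡⟨ eqx ⟩
  suc (count P′ x′)          ≤⟨ count-strict P′ x′∈ x′<u′ ⟩
  count P′ u′                ≡⟨ count-∖-> P′ x′∈ x′<u′ ⟨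
  suc (count (P′ ∖ x′) u′)   ≡⟨ eq ⟨
  count (P ∖ x) u            ≡⟨ count-∖-≤ P (<⇒≤ u<x) ⟩
  count P u                  ∎))
  where open ≤-Reasoning

module Window (ok : RowSet) (ι : Fin (suc k) → Fin n)
  (consec : ∀ a b → toℕ b ≡ suc (toℕ a) → toℕ (ι b) ≡ suc (toℕ (ι a))) where

  last : Fin n
  last = ι (fromℕ k)

  after-step : ∀ (π : Word n) {x : Fin (suc k) → ℕ} → (∀ a → lookup π (ι a) ≡ just (x a)) → (a : Fin k) →
               after ok π (ι (inject₁ a)) ≡ after ok π (ι (suc a)) ∖ x (suc a)
  after-step π at a = after-pred ok π _ _ (consec _ _ (cong suc (sym (toℕ-inject₁ a)))) (at (suc a))

  left-of-window : (π : Word n) → (∀ u → avail ok π u ≡ false) →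
                   ∀ {x : Fin (suc k) → ℕ} → (∀ a → lookup π (ι a) ≡ just (x a)) →
                   ∀ {u} → u ∈ʳ after ok π last → (∀ a → u ≢ x a) →
                   ∃ λ c → lookup π c ≡ just u × (∀ a → c <ᶠ ι a)
  left-of-window π exhausted {x} at {u} u∈ u≢ = c , e , λ a →
    ≤∧≢⇒< (after⇒≤ ok π (ι a) (stays a) c e) (λ c≡ →
      u≢ a (just-injective (trans (sym e) (trans (cong (lookup π) (toℕ-injective c≡)) (at a)))))
    where
    stays : ∀ a → u ∈ʳ after ok π (ι a)
    stays = >-weakInduction (λ a → u ∈ʳ after ok π (ι a)) u∈ λ a u∈a →
      subst (u ∈ʳ_) (sym (after-step π at a)) (∈-∖⁺ (after ok π (ι (suc a))) u∈a (u≢ (suc a)))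
    c = proj₁ (used ok π (after⇒ok ok π last u∈) (exhausted u))
    e = proj₂ (used ok π (after⇒ok ok π last u∈) (exhausted u))

  module Shift (π π′ : Word n) {x x′ : Fin (suc k) → ℕ}
    (at    : ∀ a → lookup π  (ι a) ≡ just (x  a))
    (at′   : ∀ a → lookup π′ (ι a) ≡ just (x′ a))
    (free  : ∀ a → x  a ∈ʳ after ok π  (ι a))
    (free′ : ∀ a → x′ a ∈ʳ after ok π′ (ι a))
    (shift : ∀ a → count (after ok π (ι a)) (x a) ≡ suc (count (after ok π′ (ι a)) (x′ a)))
    where

    T T′ : RowSet
    T  = after ok π  last
    T′ = after ok π′ last

    -- Ranks differing by one when column ι a is filled already differed by one before the window was.
    Lifts : Fin (suc k) → Set
    Lifts a = ∀ {u u′} → u ∈ʳ after ok π (ι a) → u′ ∈ʳ after ok π′ (ι a) →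
      count (after ok π (ι a)) u ≡ suc (count (after ok π′ (ι a)) u′) →
      u ∈ʳ T × u′ ∈ʳ T′ × count T u ≡ suc (count T′ u′)

    lifts : ∀ a → Lifts a
    lifts = >-weakInduction Lifts (λ u∈ u′∈ eq → u∈ , u′∈ , eq) step
      where
      step : ∀ a → Lifts (suc a) → Lifts (inject₁ a)
      step a ih u∈ u′∈ eq rewrite after-step π at a | after-step π′ at′ a =
        ih (proj₁ (∈-∖⁻ P u∈)) (proj₁ (∈-∖⁻ P′ u′∈))
           (∖-shift P P′ (free (suc a)) (free′ (suc a)) (shift (suc a)) u∈ u′∈ eq)
        where
        P  = after ok π  (ι (suc a))
        P′ = after ok π′ (ι (suc a))

    x∈T : ∀ a → x a ∈ʳ T
    x∈T a = proj₁ (lifts a (free a) (free′ a) (shift a))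

    x′∈T′ : ∀ a → x′ a ∈ʳ T′
    x′∈T′ a = proj₁ (proj₂ (lifts a (free a) (free′ a) (shift a)))

    shift-T : ∀ a → count T (x a) ≡ suc (count T′ (x′ a))
    shift-T a = proj₂ (proj₂ (lifts a (free a) (free′ a) (shift a)))

    -- The ranks in `shift` refer to a different set for each column. Measured in the common sets
    -- `T` and `T′`, they still differ by one everywhere, so the entries compare alike.
    same-order : ∀ a b → (x a < x b) ⇔ (x′ a < x′ b)
    same-order a b = mk⇔
      (λ lt → count-reflects-< T′ (s≤s⁻¹
        (subst₂ _<_ (shift-T a) (shift-T b) (count-strict T (x∈T a) lt))))
      (λ lt → count-reflects-< T
        (subst₂ _<_ (sym (shift-T a)) (sym (shift-T b)) (s≤s (count-strict T′ (x′∈T′ a) lt))))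

-- Transfer of occurrences along the rotation.

record Occurrence (lam : Vec ℕ n) (π : Word n) (τ : Vec ℕ (suc k)) : Set where
  field
    ι       : Fin (suc k) → Fin n
    x       : Fin (suc k) → ℕ
    mono    : ∀ a b → a <ᶠ b → ι a <ᶠ ι b
    at      : ∀ a → lookup π (ι a) ≡ just (x a)
    iso     : ∀ a b → (x a < x b) ⇔ (lookup τ a < lookup τ b)
    consec  : ∀ a b → toℕ b ≡ suc (toℕ a) → toℕ (ι b) ≡ suc (toℕ (ι a))
    fits    : ∀ a → x a ≤ lookup lam (ι (fromℕ k))

-- An occurrence of the pattern t ∷ τ with a dash after its first letter.
record Extension (lam : Vec ℕ n) (π : Word n) (t : ℕ) (τ : Vec ℕ (suc k)) : Set where
  field
    occ   : Occurrence lam π τ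
    col   : Fin n
    val   : ℕ
    colAt : lookup π col ≡ just val
    left  : ∀ a → col <ᶠ Occurrence.ι occ a
    lower : ∀ a → (val < Occurrence.x occ a) ⇔ (t < lookup τ a)
    upper : ∀ a → (Occurrence.x occ a < val) ⇔ (lookup τ a < t)
    val≤  : val ≤ lookup lam (Occurrence.ι occ (fromℕ k))
  open Occurrence occ public

private
  both : ∀ {A B : Set} → A → B → A ⇔ B
  both a b = mk⇔ (λ _ → b) (λ _ → a)

  neither : ∀ {A B : Set} → ¬ A → ¬ B → A ⇔ B
  neither ¬a ¬b = mk⇔ (λ a → contradiction a ¬a) (λ b → contradiction b ¬b)

module _ {lam : Vec ℕ n} (dec : Decreasing lam) {ok : RowSet} {π π′ : Word n}
  (R : Ranked Rotation ok lam π π′) {t t′ : ℕ} {τ τ′ : Vec ℕ (suc k)}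
  (t<τ : ∀ a → t < lookup τ a) (τ′<t′ : ∀ a → lookup τ′ a < t′)
  (τ≅τ′ : ∀ a b → (lookup τ a < lookup τ b) ⇔ (lookup τ′ a < lookup τ′ b)) where

  -- The lower entry `val` is free throughout the window, so no rank wraps around. The shift by one
  -- then leaves the highest available row above the whole window, and that row is used further
  -- left.
  below⇒above : (∀ u → avail ok π′ u ≡ false) → Extension lam π t τ → Extension lam π′ t′ τ′
  below⇒above exhausted w = record
    { occ   = record { ι = ι ; x = x′ ; mono = mono ; at = at′ ; consec = consec
                     ; iso  = λ a b → ⇔-trans (⇔-sym (same-order a b)) (⇔-trans (iso a b) (τ≅τ′ a b))
                     ; fits = λ a → ≤-trans (<⇒≤ (x′<M a)) M≤h }
    ; col   = proj₁ there
    ; val   = M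
    ; colAt = proj₁ (proj₂ there)
    ; left  = proj₂ (proj₂ there)
    ; lower = λ a → neither (<-asym (x′<M a)) (<-asym (τ′<t′ a))
    ; upper = λ a → both (x′<M a) (τ′<t′ a)
    ; val≤  = M≤h }
    where
    open Extension w
    below : ∀ a → val < x a
    below a = Equivalence.from (lower a) (t<τ a)
    x′ : Fin (suc k) → ℕ
    x′ a = proj₁ (Ranked-lookup R (ι a) (at a))
    at′ : ∀ a → lookup π′ (ι a) ≡ just (x′ a)
    at′ a = proj₁ (proj₂ (Ranked-lookup R (ι a) (at a)))
    module At a = RankedAt (proj₂ (proj₂ (Ranked-lookup R (ι a) (at a))))
    shift : ∀ a → count (after ok π (ι a)) (x a) ≡ suc (count (after ok π′ (ι a)) (x′ a))
    shift a with At.ranks a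
    ... | inj₁ (eq , _) = eq
    -- Rank 0 is impossible: `val` is free here and lies below `x a`.
    ... | inj₂ (eq , _) = contradiction (subst (count P val <_) eq (count-strict P val∈ (below a))) λ ()
      where
      P = after ok π (ι a)
      val∈ : val ∈ʳ P
      val∈ = after-mono ok π (<⇒≤ (left a))
        (RankedAt.x∈P (proj₂ (proj₂ (Ranked-lookup R col colAt))))
    open Window ok ι consec
    open Shift π π′ at at′ At.x∈P At.x′∈P′ shift
    h = lookup lam last
    -- The rank of `x′ a` is at most the number of available rows minus two, so the last rank, that
    -- of `M`, is strictly higher.
    pos : ∀ a → suc (count T′ (x′ a)) < count T′ (suc h)
    pos a = subst₂ _<_ (shift-T a) (At.same-count (fromℕ k)) (count-strict T (x∈T a) (s≤s (fits a)))
    pred< : ∀ {m a} → m < a → pred a < a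
    pred< {a = suc a} _ = ≤-refl
    spec = nth-spec T′ (suc h) (pred< (pos zero))
    M = nth T′ (suc h) (pred (count T′ (suc h)))
    M≤h : M ≤ h
    M≤h = s≤s⁻¹ (proj₁ spec)
    x′<M : ∀ a → x′ a < M
    x′<M a = count-reflects-< T′ (subst (count T′ (x′ a) <_) (sym (proj₂ (proj₂ spec))) (pred-mono-≤ (pos a)))
    there = left-of-window π′ exhausted at′ (proj₁ (proj₂ spec)) (λ a → ≢-sym (<⇒≢ (x′<M a)))

  -- Dually, the higher entry `val` keeps every window entry off the last rank. Ranks therefore go
  -- up by one, and the lowest available row is left below the window.
  above⇒below : (∀ u → avail ok π u ≡ false) → Extension lam π′ t′ τ′ → Extension lam π t τ
  above⇒below exhausted w = record
    { occ   = record { ι = ι ; x = x ; mono = mono ; at = at ; consec = consec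
                     ; iso  = λ a b → ⇔-trans (same-order a b) (⇔-trans (iso a b) (⇔-sym (τ≅τ′ a b)))
                     ; fits = λ a → s≤s⁻¹ (count-reflects-< T (x<h a)) }
    ; col   = proj₁ there
    ; val   = m
    ; colAt = proj₁ (proj₂ there)
    ; left  = proj₂ (proj₂ there)
    ; lower = λ a → both (m<x a) (t<τ a)
    ; upper = λ a → neither (<-asym (m<x a)) (<-asym (t<τ a))
    ; val≤  = ≤-trans (<⇒≤ (m<x zero)) (s≤s⁻¹ (count-reflects-< T (x<h zero))) }
    where
    open Extension w renaming (x to x′; at to at′)
    above : ∀ a → x′ a < val
    above a = Equivalence.from (upper a) (τ′<t′ a)
    R′ = Ranked-sym R
    x : Fin (suc k) → ℕ
    x a = proj₁ (Ranked-lookup R′ (ι a) (at′ a))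
    at : ∀ a → lookup π (ι a) ≡ just (x a)
    at a = proj₁ (proj₂ (Ranked-lookup R′ (ι a) (at′ a)))
    module At a = RankedAt (proj₂ (proj₂ (Ranked-lookup R′ (ι a) (at′ a))))
    val∈ : ∀ a → val ∈ʳ after ok π′ (ι a)
    val∈ a = after-mono ok π′ (<⇒≤ (left a))
      (RankedAt.x∈P (proj₂ (proj₂ (Ranked-lookup R′ col colAt))))
    ι≤last : ∀ a → ι a ≤ᶠ ι (fromℕ k)
    ι≤last a with m≤n⇒m<n∨m≡n (≤fromℕ a)
    ... | inj₁ lt = <⇒≤ (mono _ _ lt)
    ... | inj₂ eq = ≤-reflexive (cong (λ b → toℕ (ι b)) (toℕ-injective eq))
    room : ∀ a {h} → val ≤ h → suc (count (after ok π′ (ι a)) (x′ a)) < count (after ok π′ (ι a)) (suc h)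
    room a {h} val≤h =
      ≤-<-trans (count-strict (after ok π′ (ι a)) (At.x∈P a) (above a))
                (count-strict (after ok π′ (ι a)) (val∈ a) (s≤s val≤h))
    shift : ∀ a → count (after ok π (ι a)) (x a) ≡ suc (count (after ok π′ (ι a)) (x′ a))
    shift a with At.ranks a
    ... | inj₁ (eq , _) = eq
    -- A wraparound would give `x′ a` the last rank. But `val` is higher and fits in column `ι a`,
    -- because it fits in the last window column and heights decrease.
    ... | inj₂ (_ , eq) = contradiction eq (<⇒≢ (room a (≤-trans val≤ (dec _ _ (ι≤last a)))))
    open Window ok ι consec
    open Shift π π′ at at′ At.x′∈P′ At.x∈P shift
    h = lookup lam last
    -- The raised rank is at most the rank of `val`, so the new entries still fit in the last
    -- column.
    x<h : ∀ a → count T (x a) < count T (suc h)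
    x<h a = subst₂ _<_ (sym (shift-T a)) (At.same-count (fromℕ k))
      (≤-<-trans (count-strict T′ (x′∈T′ a) (above a)) (count-strict T′ (val∈ (fromℕ k)) (s≤s val≤)))
    spec = nth-spec T (suc h) (≤-<-trans z≤n (x<h zero))
    m = nth T (suc h) 0
    m<x : ∀ a → m < x a
    m<x a = count-reflects-< T (subst₂ _<_ (sym (proj₂ (proj₂ spec))) (sym (shift-T a)) (s≤s z≤n))
    there = left-of-window π exhausted at (proj₁ (proj₂ spec)) (λ a → <⇒≢ (m<x a))

-- Splitting off the first letter of an occurrence.

module _ {lam : Vec ℕ n} {π : Word n} {t : ℕ} {τ : Vec ℕ (suc k)} (Y : ℕ → Bool) where

  -- In `2 + toℕ a`, one unit accounts for the letter in front of `τ` and one for the adjacency set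
  -- being numbered from 1.
  Contains⇒Extension : (∀ (a b : Fin (suc k)) → toℕ b ≡ suc (toℕ a) → Y (2 + toℕ a) ≡ true) →
                       Contains lam π (pat (2 + k) (t ∷ τ) Y) → Extension lam π t τ
  Contains⇒Extension linked (ι , x , mono , at , iso , adj , fits) = record
    { occ = record
      { ι      = λ a → ι (suc a)
      ; x      = λ a → x (suc a)
      ; mono   = λ a b lt → mono (suc a) (suc b) (s≤s lt)
      ; at     = λ a → at (suc a)
      ; iso    = λ a b → iso (suc a) (suc b)
      ; consec = λ a b eq → adj (suc a) (suc b) (cong suc eq) (linked a b eq)
      ; fits   = λ a → fits (suc a) (suc (fromℕ k)) (cong suc (toℕ-fromℕ k)) }
    ; col   = ι zero
    ; val   = x zero
    ; colAt = at zero
    ; left  = λ a → mono zero (suc a) (s≤s z≤n)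
    ; lower = λ a → iso zero (suc a)
    ; upper = λ a → iso (suc a) zero
    ; val≤  = fits zero (suc (fromℕ k)) (cong suc (toℕ-fromℕ k)) }

  -- `Y 1 ≡ false` is the dash after the first letter; all later adjacencies are supplied by
  -- `consec`.
  Extension⇒Contains : Y 1 ≡ false → Extension lam π t τ → Contains lam π (pat (2 + k) (t ∷ τ) Y)
  Extension⇒Contains dash w = ι⁺ , x⁺ , mono⁺ , at⁺ , iso⁺ , adj⁺ , fits⁺
    where
    open Extension w
    ι⁺ : Fin (2 + k) → Fin n
    ι⁺ zero    = col
    ι⁺ (suc a) = ι a
    x⁺ : Fin (2 + k) → ℕ
    x⁺ zero    = val
    x⁺ (suc a) = x a
    mono⁺ : ∀ a b → a <ᶠ b → ι⁺ a <ᶠ ι⁺ b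
    mono⁺ zero    (suc b) lt = left b
    mono⁺ (suc a) (suc b) lt = mono a b (s≤s⁻¹ lt)
    at⁺ : ∀ a → lookup π (ι⁺ a) ≡ just (x⁺ a)
    at⁺ zero    = colAt
    at⁺ (suc a) = at a
    iso⁺ : ∀ a b → (x⁺ a < x⁺ b) ⇔ (lookup (t ∷ τ) a < lookup (t ∷ τ) b)
    iso⁺ zero    zero    = neither (<-irrefl refl) (<-irrefl refl)
    iso⁺ zero    (suc b) = lower b
    iso⁺ (suc a) zero    = upper a
    iso⁺ (suc a) (suc b) = iso a b
    adj⁺ : ∀ a b → toℕ b ≡ suc (toℕ a) → Y (suc (toℕ a)) ≡ true → toℕ (ι⁺ b) ≡ suc (toℕ (ι⁺ a))
    adj⁺ zero    b       eq link = contradiction dash (true≢false link)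
    adj⁺ (suc a) (suc b) eq link = consec a b (cong pred eq)
    fits⁺ : ∀ a l → toℕ l ≡ suc k → x⁺ a ≤ lookup lam (ι⁺ l)
    fits⁺ a (suc l) eq with toℕ-injective {i = l} {j = fromℕ k} (trans (cong pred eq) (sym (toℕ-fromℕ k)))
    fits⁺ zero    (suc _) eq | refl = val≤
    fits⁺ (suc a) (suc _) eq | refl = fits a

module _ (τ : Vec ℕ (suc k)) (B : ℕ → Bool)
  (isPat : IsPattern (pat (suc k) τ B)) (isCons : Consecutive (pat (suc k) τ B))
  {lam : Vec ℕ n} (dec : Decreasing lam) {ok : RowSet} {π π′ : Word n}
  (R : Ranked Rotation ok lam π π′) where

  private
    σ = pat (suc k) τ B

    linked : ∀ (a b : Fin (suc k)) → toℕ b ≡ suc (toℕ a) → B (suc (toℕ a)) ≡ true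
    linked a b eq = Equivalence.from (isCons (suc (toℕ a))) (s≤s z≤n , s≤s (subst (_≤ k) eq (s≤s⁻¹ (toℕ<n b))))

    lookup⁺ : ∀ a → lookup (map (_+ 1) τ) a ≡ suc (lookup τ a)
    lookup⁺ a = trans (lookup-map a (_+ 1) τ) (+-comm (lookup τ a) 1)

    τ⁺≅τ : ∀ a b → (lookup (map (_+ 1) τ) a < lookup (map (_+ 1) τ) b) ⇔ (lookup τ a < lookup τ b)
    τ⁺≅τ a b rewrite lookup⁺ a | lookup⁺ b = mk⇔ s≤s⁻¹ s≤s

    1<τ⁺ : ∀ a → 1 < lookup (map (_+ 1) τ) a
    1<τ⁺ a rewrite lookup⁺ a = s≤s (proj₁ (proj₁ isPat a))

    -- `2 + k` is the first letter of `one ⊖ σ`: the 1 of `one` raised by the length `suc k` of `σ`.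
    τ<2+k : ∀ a → lookup τ a < 2 + k
    τ<2+k a = s≤s (proj₂ (proj₁ isPat a))

  ⊕⇒⊖ : (∀ u → avail ok π′ u ≡ false) → Contains lam π (one ⊕ σ) → Contains lam π′ (one ⊖ σ)
  -- Both sums have the same adjacency set. At 1 it reduces to `false`, and at `2 + toℕ a` to
  -- `B (suc (toℕ a))`, so `refl` and `linked` fit.
  ⊕⇒⊖ exhausted = Extension⇒Contains (X (one ⊖ σ)) refl ∘
    below⇒above dec R 1<τ⁺ τ<2+k τ⁺≅τ exhausted ∘ Contains⇒Extension (X (one ⊕ σ)) linked

  ⊖⇒⊕ : (∀ u → avail ok π u ≡ false) → Contains lam π′ (one ⊖ σ) → Contains lam π (one ⊕ σ)
  ⊖⇒⊕ exhausted = Extension⇒Contains (X (one ⊕ σ)) refl ∘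
    above⇒below dec R 1<τ⁺ τ<2+k τ⁺≅τ exhausted ∘ Contains⇒Extension (X (one ⊖ σ)) linked

-- Fillings with prescribed empty rows as admissible words.

-- Rows are numbered from 1, while index i of the subset R of empty rows stands for row i + 1.
nonEmpty : Subset n → RowSet
nonEmpty _        zero    = false
nonEmpty []       (suc u) = false
nonEmpty (b ∷ bs) (suc zero)    = not b
nonEmpty (b ∷ bs) (suc (suc u)) = nonEmpty bs (suc u)

nonEmpty-lookup : (S : Subset n) (i : Fin n) → nonEmpty S (suc (toℕ i)) ≡ not (lookup S i)
nonEmpty-lookup (b ∷ S) zero    = refl
nonEmpty-lookup (b ∷ S) (suc i) = nonEmpty-lookup S i

nonEmpty⁻ : (S : Subset n) → ∀ u → u ∈ʳ nonEmpty S → ∃ λ (i : Fin n) → u ≡ suc (toℕ i)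
nonEmpty⁻ (b ∷ S) (suc zero)    _  = zero , refl
nonEmpty⁻ (b ∷ S) (suc (suc u)) u∈ = let i , eq = nonEmpty⁻ S (suc u) u∈ in suc i , cong suc eq
nonEmpty⁻ []      zero          ()
nonEmpty⁻ []      (suc u)       ()

∈nonEmpty⇒∉ : (S : Subset n) (i : Fin n) → suc (toℕ i) ∈ʳ nonEmpty S → ¬ (i ∈ S)
∈nonEmpty⇒∉ S i ok i∈ with lookup S i | nonEmpty-lookup S i | []=⇒lookup i∈
... | true | eq | _ = true≢false ok eq

∉⇒∈nonEmpty : (S : Subset n) (i : Fin n) → ¬ (i ∈ S) → suc (toℕ i) ∈ʳ nonEmpty S
∉⇒∈nonEmpty S i i∉ with lookup S i in eq | nonEmpty-lookup S i
... | true  | _  = contradiction (lookup⇒[]= i S eq) i∉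
... | false | ok = ok

module _ (lam : Vec ℕ n) (young : IsYoung lam) (R : Subset (height lam)) where

  private
    ok = nonEmpty R

    lookup≤height : (lam : Vec ℕ n) → Decreasing lam → ∀ c → lookup lam c ≤ height lam
    lookup≤height (h ∷ lam) dec c = dec zero c z≤n

    ok⇒≤height : ∀ {u} → u ∈ʳ ok → u ≤ height lam
    ok⇒≤height {u} u∈ = let i , eq = nonEmpty⁻ R u u∈ in subst (_≤ height lam) (sym eq) (toℕ<n i)

  filling⇒Admissible : ∀ π → IsFilling lam π → EmptyRows lam π R → Admissible ok lam π
  filling⇒Admissible π (bounds , inj) rows = entries , inj
    where
    entries : ∀ c x → lookup π c ≡ just x → x ∈ʳ ok × x ≤ lookup lam c
    entries c zero    e = contradiction (proj₁ (bounds c 0 e)) λ ()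
    entries c (suc r) e = subst (λ r → suc r ∈ʳ ok) toℕ-i ok-i , r<lam
      where
      r<lam = proj₂ (bounds c (suc r) e)
      r<height = ≤-trans r<lam (lookup≤height lam (proj₁ young) c)
      i = fromℕ< r<height
      toℕ-i : toℕ i ≡ r
      toℕ-i = toℕ-fromℕ< r<height
      ok-i : suc (toℕ i) ∈ʳ ok
      ok-i = ∉⇒∈nonEmpty R i λ i∈R →
        Equivalence.to (rows i) i∈R c (trans e (cong (just ∘ suc) (sym toℕ-i)))

  EmptyRows⇒exhausted : ∀ π → EmptyRows lam π R → ∀ u → avail ok π u ≡ false
  EmptyRows⇒exhausted π rows u with avail ok π u in u∈
  ... | false = refl
  ... | true  = contradiction (Equivalence.from (rows i) (subst (λ u → ∀ c → lookup π c ≢ just u) eq unused))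
                              (∈nonEmpty⇒∉ R i (subst (_∈ʳ ok) eq u∈ok))
    where
    u∈ok   = proj₁ (avail⁻ ok π u∈)
    unused = proj₂ (avail⁻ ok π u∈)
    i  = proj₁ (nonEmpty⁻ R u u∈ok)
    eq = proj₂ (nonEmpty⁻ R u u∈ok)

  -- Both words leave equally many rows of height at most `height lam`, and `ok` contains no higher
  -- ones.
  Ranked-exhausted : ∀ {S π π′} → Ranked S ok lam π π′ →
                     (∀ u → avail ok π u ≡ false) → ∀ u → avail ok π′ u ≡ false
  Ranked-exhausted {π = π} {π′} rk exhausted u with avail ok π′ u in u∈
  ... | false = refl
  ... | true  = contradiction (count≡0⇒∉ (avail ok π′) none (s≤s (ok⇒≤height (proj₁ (avail⁻ ok π′ u∈)))))
                              (true≢false u∈)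
    where
    none : count (avail ok π′) (suc (height lam)) ≡ 0
    none = trans (sym (Ranked-count (lookup≤height lam (proj₁ young)) rk))
                 (∉⇒count≡0 (avail ok π) exhausted (suc (height lam)))

  Admissible⇒IsFilling : ∀ π → Admissible ok lam π → IsFilling lam π
  Admissible⇒IsFilling π (entries , inj) = (λ c x e → let x∈ , x≤ = entries c x e in 1≤ x∈ , x≤) , inj
    where
    1≤ : ∀ {x} → x ∈ʳ ok → 1 ≤ x
    1≤ {zero}  ()
    1≤ {suc x} _ = s≤s z≤n

  exhausted⇒EmptyRows : ∀ π → Admissible ok lam π → (∀ u → avail ok π u ≡ false) → EmptyRows lam π R
  exhausted⇒EmptyRows π (entries , _) exhausted i = mk⇔
    (λ i∈R c e → ∈nonEmpty⇒∉ R i (proj₁ (entries c _ e)) i∈R)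
    (λ unused → decidable-stable (i ∈? R) λ i∉R →
      let c , e = used ok π (∉⇒∈nonEmpty R i i∉R) (exhausted _) in unused c e)

  -- Serves both directions of the bijection, with `S` the rotation or its converse. Avoidance is
  -- carried over contrapositively: an occurrence of `q` in the image is pulled back to one of `p`.
  Fill-transfer : ∀ {S} p q {C} (f : Word n → Word n) →
    (∀ π → Admissible ok lam π → Ranked S ok lam π (f π)) →
    (∀ {π π′} → Ranked S ok lam π π′ → (∀ u → avail ok π u ≡ false) →
       Contains lam π′ q → Contains lam π p) →
    Fill lam C R p → Fill lam C R q
  Fill-transfer p q f ranked back (π , filling , cols , rows , avoids) =
    f π , Admissible⇒IsFilling (f π) adm′ ,
    (λ c → ⇔-trans (cols c) (mk⇔ (Ranked-empty rk c) (Ranked-empty (Ranked-sym rk) c))) ,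
    exhausted⇒EmptyRows (f π) adm′ (Ranked-exhausted rk exhausted) ,
    avoids ∘ back rk exhausted
    where
    rk = ranked π (filling⇒Admissible π filling rows)
    adm′ = Ranked⇒Admissible (Ranked-sym rk)
    exhausted = EmptyRows⇒exhausted π rows

-- The bijection and its inverse.

theorem3p11 : (σ : Pat) → IsPattern σ → Consecutive σ → FSWE (one ⊕ σ) (one ⊖ σ)
-- For empty `σ` both sums reduce to the same pattern of length 1.
theorem3p11 (pat zero [] B) isPat isCons n lam young C R = Identity.inverse _
theorem3p11 σ@(pat (suc k) τ B) isPat isCons n lam young@(dec , _) C R = record
  { to        = to
  ; from      = from
  ; to-cong   = cong (rerank ok down lam)
  ; from-cong = cong (rerank ok up lam)
  ; inverse   = (λ {y} {x} → λ { refl → to∘from y }) , (λ {x} {y} → λ { refl → from∘to x })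
  }
  where
  ok = nonEmpty R

  down-ranked : ∀ π → Admissible ok lam π → Ranked Rotation ok lam π (rerank ok down lam π)
  down-ranked = Ranked-rerank ok down down-rotation lam dec

  up-ranked : ∀ π → Admissible ok lam π →
              Ranked (λ a → flip (Rotation a)) ok lam π (rerank ok up lam π)
  up-ranked = Ranked-rerank ok up up-rotation lam dec

  to : Fill lam C R (one ⊕ σ) → Fill lam C R (one ⊖ σ)
  to = Fill-transfer lam young R (one ⊕ σ) (one ⊖ σ) (rerank ok down lam) down-ranked (⊖⇒⊕ τ B isPat isCons dec)

  from : Fill lam C R (one ⊖ σ) → Fill lam C R (one ⊕ σ)
  from = Fill-transfer lam young R (one ⊖ σ) (one ⊕ σ) (rerank ok up lam) up-ranked
    (λ rk → ⊕⇒⊖ τ B isPat isCons dec (Ranked-sym rk))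

  to∘from : ∀ y → proj₁ (to (from y)) ≡ proj₁ y
  -- The round trip and `π` itself are both rotations of the same word, the filling of `from y`.
  to∘from (π , filling , _ , rows , _) = Ranked-functional Rotation-functional
    (down-ranked _ (Ranked⇒Admissible (Ranked-sym rk))) (Ranked-sym rk)
    where rk = up-ranked π (filling⇒Admissible lam young R π filling rows)

  from∘to : ∀ x → proj₁ (from (to x)) ≡ proj₁ x
  -- Here the relation is the converse rotation, so its functionality is the injectivity of
  -- `Rotation`.
  from∘to (π , filling , _ , rows , _) = Ranked-functional Rotation-injective
    (up-ranked _ (Ranked⇒Admissible (Ranked-sym rk))) (Ranked-sym rk)
    where rk = down-ranked π (filling⇒Admissible lam young R π filling rows)
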